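{- For every $\alpha>1$, the runtime of LOHification of rank $\alpha$ by partitioning on the pivot closest to the center of the array is in $O\left(n\log\left(\frac{\alpha}{\alpha-1}\right)\right)$.
   Context: Layer-ordered heap (LOH) of rank $\alpha\ge 1$ on $n$ elements: a partition of an array of $n$ mutually comparable (distinct) values into consecutive layers $L_0\le L_1\le\cdots\le L_{\ell-1}$ (every element of $L_i$ is $\le$ every element of $L_{i+1}$), each layer being internally unordered. With pivots $p_i=\left\lceil\sum_{j=0}^{i}\alpha^j\right\rceil$, the layer sizes are $|L_0|=p_0=1$, $|L_i|=p_i-p_{i-1}$, and the last layer contains the remaining elements beyond the last pivot that is at most $n$. LOHification of rank $\alpha$ is the problem of rearranging an arbitrary array of length $n$ into a LOH of rank $\alpha$. Partitioning on the pivot closest to the center of the array: compute the pivots $p_i$; perform a linear-time one-dimensional selection on the pivot closest to the middle index of the current (sub)array and partition the (sub)array about that element; recurse on the two parts; stop on a (sub)array that contains no pivot. Its runtime is $r(0,n)$, where, with $m(n_s,n_e)$ the number of pivots strictly between indices $n_s$ and $n_e$ and $x(n_s,n_e)$ the index of the pivot closest to the middle of the (sub)array from $n_s$ to $n_e$, one has $r(n_s,n_e)=0$ if $n_s\ge n_e$ or $m(n_s,n_e)=0$, and otherwise $r(n_s,n_e)=n_e-n_s+r(n_s,x(n_s,n_e)-1)+r(x(n_s,n_e)+1,n_e)$ (up to constant factors). Asymptotics are as $n\to\infty$ for the given $\alpha$. -}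

module Defs where

open import Algebra.Bundles using (CommutativeRing)
open import Data.Empty using (⊥; ⊥-elim)
import Data.Integer.Base as ℤ
import Data.Integer.Properties as ℤₚ
open import Data.List.Base using (length; filter; upTo)
open import Data.Nat.Base as ℕ using (ℕ; zero; suc)
import Data.Nat.Properties as ℕₚ
open import Data.Product.Base using (Σ; ∃; ∃-syntax; _×_; _,_; proj₁; proj₂)
open import Data.Rational.Base
open import Data.Rational.Properties
import Data.Rational.Unnormalised.Base as ℚᵘ
import Data.Rational.Unnormalised.Properties as ℚᵘₚ
open import Data.Rational.Solver using (module +-*-Solver)
open import Data.Sum.Base using (_⊎_; inj₁; inj₂; swap)
open import Relation.Binary.PropositionalEquality
  using (_≡_; _≢_; refl; sym; trans; cong; cong₂; subst; subst₂)
open import Relation.Nullary.Decidable using (yes; no; _×-dec_)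
open import Relation.Binary.Definitions using (tri<; tri≈; tri>)

open import Algebra.Properties.CommutativeSemiring.Exp
  (CommutativeRing.commutativeSemiring +-*-commutativeRing)
  using (_^_; ^-homo-*; ^-assocʳ; ^-distrib-*)

open +-*-Solver

≤-by : ∀ {p q} d → 0ℚ ≤ d → p + d ≡ q → p ≤ q
≤-by {p} d 0≤d refl = subst (_≤ p + d) (+-identityʳ p) (+-monoʳ-≤ p 0≤d)

<-by : ∀ {p q} d → 0ℚ < d → p + d ≡ q → p < q
<-by {p} d 0<d refl = subst (_< p + d) (+-identityʳ p) (+-monoʳ-< p 0<d)

p+[q-p]≡q : ∀ p q → p + (q - p) ≡ q
p+[q-p]≡q = solve 2 (λ p q → p :+ (q :- p) := q) refl

0≤q-p : ∀ {p q} → p ≤ q → 0ℚ ≤ q - p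
0≤q-p {p} {q} p≤q = subst (_≤ q - p) (+-inverseʳ p) (+-monoˡ-≤ (- p) p≤q)

0<q-p : ∀ {p q} → p < q → 0ℚ < q - p
0<q-p {p} {q} p<q = subst (_< q - p) (+-inverseʳ p) (+-monoˡ-< (- p) p<q)

0≤+ : ∀ {p q} → 0ℚ ≤ p → 0ℚ ≤ q → 0ℚ ≤ p + q
0≤+ 0≤p 0≤q = +-mono-≤ 0≤p 0≤q

0≤* : ∀ {p q} → 0ℚ ≤ p → 0ℚ ≤ q → 0ℚ ≤ p * q
0≤* {p} {q} 0≤p 0≤q = nonNegative⁻¹ (p * q)
  {{nonNeg*nonNeg⇒nonNeg p {{nonNegative 0≤p}} q {{nonNegative 0≤q}}}}

0<* : ∀ {p q} → 0ℚ < p → 0ℚ < q → 0ℚ < p * q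
0<* {p} {q} 0<p 0<q = positive⁻¹ (p * q)
  {{pos*pos⇒pos p {{positive 0<p}} q {{positive 0<q}}}}

*-mono-0≤ : ∀ {p p′ q q′} → 0ℚ ≤ p → p ≤ p′ → 0ℚ ≤ q → q ≤ q′ → p * q ≤ p′ * q′
*-mono-0≤ {p} {p′} {q} {q′} 0≤p p≤p′ 0≤q q≤q′ = ≤-trans
  (*-monoʳ-≤-nonNeg q {{nonNegative 0≤q}} p≤p′)
  (*-monoˡ-≤-nonNeg p′ {{nonNegative (≤-trans 0≤p p≤p′)}} q≤q′)

0<1 : 0ℚ < 1ℚ
0<1 = positive⁻¹ 1ℚ

0<½ : 0ℚ < ½
0<½ = positive⁻¹ ½

2ℚ : ℚ
2ℚ = 1ℚ + 1ℚ

0<2 : 0ℚ < 2ℚ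
0<2 = positive⁻¹ 2ℚ

inverse : ∀ {p} → 0ℚ < p → ∃[ r ] 0ℚ < r × r * p ≡ 1ℚ
inverse {p} 0<p = 1/ p , positive⁻¹ (1/ p) {{1/pos⇒pos p}} , *-inverseˡ p
  where instance
    p⁺ = positive 0<p
    p≢0 = pos⇒nonZero p

ι : ℕ → ℚ
ι n = ℤ.+ n / 1

ι-suc : ∀ n → ι (suc n) ≡ 1ℚ + ι n
ι-suc n = toℚᵘ-injective (ℚᵘₚ.≃-trans (lem (suc n)) (ℚᵘₚ.≃-trans step
  (ℚᵘₚ.≃-sym (ℚᵘₚ.≃-trans (toℚᵘ-homo-+ 1ℚ (ι n)) (ℚᵘₚ.+-congʳ ℚᵘ.1ℚᵘ (lem n))))))
  where
  lem : ∀ m → toℚᵘ (ι m) ℚᵘ.≃ ℚᵘ.mkℚᵘ (ℤ.+ m) 0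
  lem m = toℚᵘ-fromℚᵘ (ℚᵘ.mkℚᵘ (ℤ.+ m) 0)
  step : ℚᵘ.mkℚᵘ (ℤ.+ suc n) 0 ℚᵘ.≃ ℚᵘ.1ℚᵘ ℚᵘ.+ ℚᵘ.mkℚᵘ (ℤ.+ n) 0
  step = ℚᵘ.*≡* (cong (ℤ._* ℤ.+ 1) (cong (λ k → ℤ.1ℤ ℤ.+ k) (sym (ℤₚ.*-identityʳ (ℤ.+ n)))))

0≤ι : ∀ n → 0ℚ ≤ ι n
0≤ι zero = ≤-refl
0≤ι (suc n) = subst (0ℚ ≤_) (sym (ι-suc n)) (0≤+ (<⇒≤ 0<1) (0≤ι n))

1≤ι-suc : ∀ n → 1ℚ ≤ ι (suc n)
1≤ι-suc n = ≤-by (ι n) (0≤ι n) (sym (ι-suc n))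

ι-+ : ∀ m n → ι (m ℕ.+ n) ≡ ι m + ι n
ι-+ zero n = sym (+-identityˡ (ι n))
ι-+ (suc m) n = trans (ι-suc (m ℕ.+ n)) (trans (cong (1ℚ +_) (ι-+ m n))
  (trans (sym (+-assoc 1ℚ (ι m) (ι n))) (cong (_+ ι n) (sym (ι-suc m)))))

ι-* : ∀ m n → ι (m ℕ.* n) ≡ ι m * ι n
ι-* zero n = sym (*-zeroˡ (ι n))
ι-* (suc m) n = trans (ι-+ n (m ℕ.* n)) (trans (cong (ι n +_) (ι-* m n))
  (trans (solve 2 (λ x y → x :+ y :* x := (con 1ℚ :+ y) :* x) refl (ι n) (ι m))
         (cong (_* ι n) (sym (ι-suc m)))))

ι-mono-≤ : ∀ {m n} → m ℕ.≤ n → ι m ≤ ι n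
ι-mono-≤ {m} {n} m≤n = ≤-by (ι (n ℕ.∸ m)) (0≤ι (n ℕ.∸ m))
  (trans (sym (ι-+ m (n ℕ.∸ m))) (cong ι (ℕₚ.m+[n∸m]≡n m≤n)))

ι-cancel-< : ∀ {m n} → ι m < ι n → m ℕ.< n
ι-cancel-< {m} {n} ιm<ιn with m ℕₚ.<? n
... | yes m<n = m<n
... | no m≮n = ⊥-elim (<-irrefl refl (<-≤-trans ιm<ιn (ι-mono-≤ (ℕₚ.≮⇒≥ m≮n))))

ι-bound : ∀ p → ∃[ n ] p < ι n
ι-bound p@(mkℚ i d _) = suc ℤ.∣ i ∣ , toℚᵘ-cancel-<
  (ℚᵘₚ.<-respʳ-≃ (ℚᵘₚ.≃-sym (toℚᵘ-fromℚᵘ (ℚᵘ.mkℚᵘ (ℤ.+ suc ℤ.∣ i ∣) 0)))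
    (ℚᵘ.*<* (lem i)))
  where
  lem : ∀ j → j ℤ.* ℤ.+ 1 ℤ.< ℤ.+ suc ℤ.∣ j ∣ ℤ.* ℤ.+ suc d
  lem (ℤ.+ n) = ℤₚ.<-≤-trans
    (subst (ℤ._< ℤ.+ suc n) (sym (ℤₚ.*-identityʳ (ℤ.+ n))) (ℤ.+<+ (ℕₚ.n<1+n n)))
    (ℤ.+≤+ (ℕₚ.m≤m*n (suc n) (suc d)))
  lem ℤ.-[1+ n ] = ℤ.-<+

archimedean : ∀ p {ε} → 0ℚ < ε → ∃[ n ] p < ι n * ε
archimedean p {ε} 0<ε =
  let r , 0<r , rε≡1 = inverse 0<ε
      n , pr<n = ι-bound (p * r)
  in n , subst (_< ι n * ε)
       (trans (*-assoc p r ε) (trans (cong (p *_) rε≡1) (*-identityʳ p)))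
       (*-monoˡ-<-pos ε {{positive 0<ε}} pr<n)

natCeiling : ∀ {p} → 0ℚ ≤ p → ∃[ m ] p < ι m × ι m ≤ p + 1ℚ
natCeiling {p} 0≤p = let n , p<n = ι-bound p in search n p<n
  where
  search : ∀ n → p < ι n → ∃[ m ] p < ι m × ι m ≤ p + 1ℚ
  search zero p<0 = ⊥-elim (<-irrefl refl (≤-<-trans 0≤p p<0))
  search (suc n) p<1+n with p <? ι n
  ... | yes p<n = search n p<n
  ... | no p≮n = suc n , p<1+n ,
    subst₂ _≤_ (sym (ι-suc n)) (+-comm 1ℚ p) (+-monoʳ-≤ 1ℚ (≮⇒≥ p≮n))

0≤^ : ∀ {p} n → 0ℚ ≤ p → 0ℚ ≤ p ^ n
0≤^ zero 0≤p = <⇒≤ 0<1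
0≤^ (suc n) 0≤p = 0≤* 0≤p (0≤^ n 0≤p)

0<^ : ∀ {p} n → 0ℚ < p → 0ℚ < p ^ n
0<^ zero 0<p = 0<1
0<^ (suc n) 0<p = 0<* 0<p (0<^ n 0<p)

^-mono-≤ : ∀ {p q} n → 0ℚ ≤ p → p ≤ q → p ^ n ≤ q ^ n
^-mono-≤ zero 0≤p p≤q = ≤-refl
^-mono-≤ (suc n) 0≤p p≤q = *-mono-0≤ 0≤p p≤q (0≤^ n 0≤p) (^-mono-≤ n 0≤p p≤q)

ι≤2^ : ∀ n → ι (suc n) ≤ 2ℚ ^ n
ι≤2^ zero = ≤-refl
ι≤2^ (suc n) = ≤-trans
  (≤-by (ι n) (0≤ι n) (trans (cong (_+ ι n) (trans (ι-suc (suc n)) (cong (1ℚ +_) (ι-suc n))))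
    (trans (solve 1 (λ x → con 1ℚ :+ (con 1ℚ :+ x) :+ x := con 2ℚ :* (con 1ℚ :+ x)) refl (ι n))
      (cong (2ℚ *_) (sym (ι-suc n))))))
  (*-monoˡ-≤-nonNeg 2ℚ (ι≤2^ n))

2^-mono-< : ∀ {m n} → m ℕ.< n → 2ℚ ^ m < 2ℚ ^ n
2^-mono-< {zero} {suc n} _ = <-≤-trans
  (<-≤-trans (<-by 1ℚ 0<1 refl) (≤-by (ι n) (0≤ι n) refl′)) (ι≤2^ (suc n))
  where
  refl′ : 2ℚ + ι n ≡ ι (suc (suc n))
  refl′ = trans (+-assoc 1ℚ 1ℚ (ι n)) (sym (trans (ι-suc (suc n)) (cong (1ℚ +_) (ι-suc n))))
2^-mono-< {suc m} {suc n} (ℕ.s≤s m<n) = *-monoʳ-<-pos 2ℚ (2^-mono-< m<n)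

bernoulli : ∀ {δ} n → 0ℚ ≤ δ → δ ≤ 1ℚ → 1ℚ - ι n * δ ≤ (1ℚ - δ) ^ n
bernoulli {δ} zero 0≤δ δ≤1 = ≤-reflexive (cong (λ z → 1ℚ - z) (*-zeroˡ δ))
bernoulli {δ} (suc n) 0≤δ δ≤1 = ≤-trans
  (≤-by (ι n * (δ * δ)) (0≤* (0≤ι n) (0≤* 0≤δ 0≤δ))
    (trans (cong (λ z → 1ℚ - z * δ + ι n * (δ * δ)) (ι-suc n))
      (solve 2 (λ x d → con 1ℚ :- (con 1ℚ :+ x) :* d :+ x :* (d :* d)
                        := (con 1ℚ :- d) :* (con 1ℚ :- x :* d)) refl (ι n) δ)))
  (*-monoˡ-≤-nonNeg (1ℚ - δ) {{nonNegative (0≤q-p δ≤1)}} (bernoulli n 0≤δ δ≤1))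

-- Two-sided located Dedekind cuts of ℚ.
-- L x p means p < x and U x p means x < p.

record ℝ : Set₁ where
  field
    L U      : ℚ → Set
    L-inhab  : ∃ L
    U-inhab  : ∃ U
    L-down   : ∀ {p q} → p < q → L q → L p
    U-up     : ∀ {p q} → p < q → U p → U q
    L-open   : ∀ {p} → L p → ∃[ q ] p < q × L q
    U-open   : ∀ {q} → U q → ∃[ p ] p < q × U p
    disjoint : ∀ {p} → L p → U p → ⊥
    located  : ∀ {p q} → p < q → L p ⊎ U q

open ℝ

infix 4 _≤ᴿ_ _<ᴿ_

_≤ᴿ_ : ℝ → ℝ → Set
x ≤ᴿ y = ∀ p → L x p → L y p

_<ᴿ_ : ℝ → ℝ → Set
x <ᴿ y = ∃[ p ] U x p × L y p

fromℚ : ℚ → ℝ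
fromℚ r = record
  { L = _< r
  ; U = r <_
  ; L-inhab = r - 1ℚ , <-by 1ℚ 0<1 (solve 1 (λ r → r :- con 1ℚ :+ con 1ℚ := r) refl r)
  ; U-inhab = r + 1ℚ , <-by 1ℚ 0<1 refl
  ; L-down = <-trans
  ; U-up = λ p<q r<p → <-trans r<p p<q
  ; L-open = λ p<r → <-dense p<r
  ; U-open = λ r<q → let m , r<m , m<q = <-dense r<q in m , m<q , r<m
  ; disjoint = <-asym
  ; located = loc
  }
  where
  loc : ∀ {p q} → p < q → p < r ⊎ r < q
  loc {p} p<q with p <? r
  ... | yes p<r = inj₁ p<r
  ... | no p≮r = inj₂ (≤-<-trans (≮⇒≥ p≮r) p<q)

fromℕ : ℕ → ℝ
fromℕ n = fromℚ (ι n)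

0ᴿ 1ᴿ : ℝ
0ᴿ = fromℚ 0ℚ
1ᴿ = fromℚ 1ℚ

L<U : ∀ x {p q} → L x p → U x q → p < q
L<U x {p} {q} Lp Uq with <-cmp p q
... | tri< p<q _ _ = p<q
... | tri≈ _ refl _ = ⊥-elim (disjoint x Lp Uq)
... | tri> _ _ q<p = ⊥-elim (disjoint x Lp (U-up x q<p Uq))

L-⊔ : ∀ x {p q} → L x p → L x q → L x (p ⊔ q)
L-⊔ x {p} {q} Lp Lq with ≤-total p q
... | inj₁ p≤q = subst (L x) (sym (p≤q⇒p⊔q≡q p≤q)) Lq
... | inj₂ q≤p = subst (L x) (sym (p≥q⇒p⊔q≡p q≤p)) Lp

U-⊓ : ∀ x {p q} → U x p → U x q → U x (p ⊓ q)
U-⊓ x {p} {q} Up Uq with ≤-total p q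
... | inj₁ p≤q = subst (U x) (sym (p≤q⇒p⊓q≡p p≤q)) Up
... | inj₂ q≤p = subst (U x) (sym (p≥q⇒p⊓q≡q q≤p)) Uq

approximate : ∀ x {ε} → 0ℚ < ε → ∃[ a ] ∃[ b ] L x a × U x b × b ≤ a + ε
approximate x {ε} 0<ε =
  let a , La = L-inhab x
      b , Ub = U-inhab x
      n , b-a<nδ = archimedean (b - a) 0<δ
  in march n a La (U-up x (subst (_< a + ι n * δ) (p+[q-p]≡q a b) (+-monoʳ-< a b-a<nδ)) Ub)
  where
  δ = ε * ½
  0<δ = 0<* 0<ε 0<½
  march : ∀ n a → L x a → U x (a + ι n * δ) → ∃[ a ] ∃[ b ] L x a × U x b × b ≤ a + ε
  march zero a La Ua = ⊥-elim (disjoint x La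
    (subst (U x) (trans (cong (a +_) (*-zeroˡ δ)) (+-identityʳ a)) Ua))
  march (suc n) a La Ub with located x (<-by {a + δ} {a + δ + δ} δ 0<δ refl)
  ... | inj₁ La+δ = march n (a + δ) La+δ (subst (U x)
        (trans (cong (λ z → a + z * δ) (ι-suc n))
          (solve 3 (λ a n d → a :+ (con 1ℚ :+ n) :* d := a :+ d :+ n :* d) refl a (ι n) δ)) Ub)
  ... | inj₂ Ua+2δ = a , a + δ + δ , La , Ua+2δ , ≤-reflexive
        (solve 2 (λ a e → a :+ e :* con ½ :+ e :* con ½ := a :+ e) refl a ε)

approximateWithin : ∀ x {a₀ b₀ ε} → L x a₀ → U x b₀ → 0ℚ < ε →
  ∃[ a ] ∃[ b ] L x a × U x b × a₀ ≤ a × b ≤ b₀ × b ≤ a + ε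
approximateWithin x {a₀} {b₀} {ε} La₀ Ub₀ 0<ε =
  let a , b , La , Ub , b≤a+ε = approximate x 0<ε
  in a₀ ⊔ a , b₀ ⊓ b , L-⊔ x La₀ La , U-⊓ x Ub₀ Ub , p≤p⊔q a₀ a , p⊓q≤p b₀ b ,
     ≤-trans (p⊓q≤q b₀ b) (≤-trans b≤a+ε (+-monoˡ-≤ ε (p≤q⊔p a₀ a)))

-- A locally uniformly continuous f on ℚ × ℚ extends
-- to ℝ × ℝ: p < f x y iff some q > p is a lower bound of f on the rational
-- points of a rational box around (x , y), and dually for f x y < p.

record Box (x y : ℝ) : Set where
  field
    {x₁ x₂ y₁ y₂} : ℚ
    Lx : L x x₁
    Ux : U x x₂
    Ly : L y y₁
    Uy : U y y₂

_,_∈_ : ℚ → ℚ → ∀ {x y} → Box x y → Set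
s , t ∈ B = (x₁ ≤ s × s ≤ x₂) × (y₁ ≤ t × t ≤ y₂)
  where open Box B

LocallyUniformlyContinuous : (ℚ → ℚ → ℚ) → Set₁
LocallyUniformlyContinuous f = ∀ x y {ε} → 0ℚ < ε →
  Σ (Box x y) λ B → ∃[ v ] (∀ s t → s , t ∈ B → v - ε ≤ f s t × f s t ≤ v + ε)

module _ (f : ℚ → ℚ → ℚ) (f-cont : LocallyUniformlyContinuous f) where

  lift₂ : ℝ → ℝ → ℝ
  lift₂ x y = record
    { L = Lower
    ; U = Upper
    ; L-inhab =
        let B , v , bd = f-cont x y 0<1
        in v - 1ℚ - 1ℚ , v - 1ℚ , <-by 1ℚ 0<1 (p-1+1 (v - 1ℚ)) , B ,
           λ s t st∈B → proj₁ (bd s t st∈B)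
    ; U-inhab =
        let B , v , bd = f-cont x y 0<1
        in v + 1ℚ + 1ℚ , v + 1ℚ , <-by 1ℚ 0<1 refl , B ,
           λ s t st∈B → proj₂ (bd s t st∈B)
    ; L-down = λ p<q (q′ , q<q′ , B , bd) → q′ , <-trans p<q q<q′ , B , bd
    ; U-up = λ p<q (p′ , p′<p , B , bd) → p′ , <-trans p′<p p<q , B , bd
    ; L-open = λ (q , p<q , B , bd) →
        let m , p<m , m<q = <-dense p<q in m , p<m , q , m<q , B , bd
    ; U-open = λ (q , q<p , B , bd) →
        let m , q<m , m<p = <-dense q<p in m , m<p , q , q<m , B , bd
    ; disjoint = disj
    ; located = loc
    }
    where
    Lower Upper : ℚ → Set
    Lower p = ∃[ q ] p < q × Σ (Box x y) λ B → ∀ s t → s , t ∈ B → q ≤ f s t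
    Upper p = ∃[ q ] q < p × Σ (Box x y) λ B → ∀ s t → s , t ∈ B → f s t ≤ q

    p-1+1 : ∀ p → p - 1ℚ + 1ℚ ≡ p
    p-1+1 = solve 1 (λ p → p :- con 1ℚ :+ con 1ℚ := p) refl

    disj : ∀ {p} → Lower p → Upper p → ⊥
    disj (q , p<q , B , lo) (q′ , q′<p , B′ , hi) =
      <-irrefl refl (<-≤-trans (<-trans q′<p p<q) (≤-trans
        (lo s t ((p≤p⊔q B.x₁ B′.x₁ , <⇒≤ (L<U x Ls B.Ux)) ,
                 (p≤p⊔q B.y₁ B′.y₁ , <⇒≤ (L<U y Lt B.Uy))))
        (hi s t ((p≤q⊔p B.x₁ B′.x₁ , <⇒≤ (L<U x Ls B′.Ux)) ,
                 (p≤q⊔p B.y₁ B′.y₁ , <⇒≤ (L<U y Lt B′.Uy))))))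
      where
      module B = Box B
      module B′ = Box B′
      s = B.x₁ ⊔ B′.x₁
      t = B.y₁ ⊔ B′.y₁
      Ls = L-⊔ x B.Lx B′.Lx
      Lt = L-⊔ y B.Ly B′.Ly

    loc : ∀ {p q} → p < q → Lower p ⊎ Upper q
    loc {p} {q} p<q
      with p′ , p<p′ , p′<q ← <-dense p<q
      with q′ , p′<q′ , q′<q ← <-dense p′<q
      with f-cont x y (0<* (0<q-p p′<q′) 0<½)
    ... | B , v , bd with ≤-total (p′ + (q′ - p′) * ½) v
    ...   | inj₁ m≤v = inj₁ (p′ , p<p′ , B , λ s t st∈B → ≤-trans
              (subst (_≤ v - ε) (solve 2 (λ p e → p :+ e :- e := p) refl p′ ε) (+-monoˡ-≤ (- ε) m≤v))
              (proj₁ (bd s t st∈B)))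
      where ε = (q′ - p′) * ½
    ...   | inj₂ v≤m = inj₂ (q′ , q′<q , B , λ s t st∈B → ≤-trans (proj₂ (bd s t st∈B))
              (subst (v + ε ≤_)
                (solve 2 (λ p q → p :+ (q :- p) :* con ½ :+ (q :- p) :* con ½ := q) refl p′ q′)
                (+-monoˡ-≤ ε v≤m)))
      where ε = (q′ - p′) * ½

+-cont : LocallyUniformlyContinuous _+_
+-cont x y {ε} 0<ε =
  let a , b , La , Ub , b≤a+δ = approximate x 0<δ
      c , d , Lc , Ud , d≤c+δ = approximate y 0<δ
  in record { Lx = La ; Ux = Ub ; Ly = Lc ; Uy = Ud } , a + c ,
     λ s t ((a≤s , s≤b) , (c≤t , t≤d)) →
       ≤-trans (≤-by ε (<⇒≤ 0<ε) (solve 2 (λ v e → v :- e :+ e := v) refl (a + c) ε))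
               (+-mono-≤ a≤s c≤t) ,
       ≤-trans (+-mono-≤ (≤-trans s≤b b≤a+δ) (≤-trans t≤d d≤c+δ)) (≤-reflexive
         (solve 3 (λ a c e → a :+ e :* con ½ :+ (c :+ e :* con ½) := a :+ c :+ e) refl a c ε))
  where
  δ = ε * ½
  0<δ = 0<* 0<ε 0<½

∣∣-bounds : ∀ p → p ≤ ∣ p ∣ × - ∣ p ∣ ≤ p
∣∣-bounds p = p≤∣p∣ p , subst (- ∣ p ∣ ≤_) (solve 1 (λ p → :- (:- p) := p) refl p)
  (neg-antimono-≤ (subst (- p ≤_) (∣-p∣≡∣p∣ p) (p≤∣p∣ (- p))))
  where
  p≤∣p∣ : ∀ p → p ≤ ∣ p ∣
  p≤∣p∣ p with ≤-total 0ℚ p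
  ... | inj₁ 0≤p = ≤-reflexive (sym (0≤p⇒∣p∣≡p 0≤p))
  ... | inj₂ p≤0 = ≤-trans p≤0 (0≤∣p∣ p)

scaled-bound : ∀ {M s u η} → 0ℚ ≤ M → - M ≤ s → s ≤ M → 0ℚ ≤ u → u ≤ η →
  - (M * η) ≤ s * u × s * u ≤ M * η
scaled-bound {M} {s} {u} {η} 0≤M -M≤s s≤M 0≤u u≤η =
  ≤-trans (≤-trans (neg-antimono-≤ (*-monoˡ-≤-nonNeg M {{nonNegative 0≤M}} u≤η))
                   (≤-reflexive (neg-distribˡ-* M u)))
          (*-monoʳ-≤-nonNeg u {{nonNegative 0≤u}} -M≤s) ,
  ≤-trans (*-monoʳ-≤-nonNeg u {{nonNegative 0≤u}} s≤M)
          (*-monoˡ-≤-nonNeg M {{nonNegative 0≤M}} u≤η)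

product-bounds : ∀ {M η a b c d s t} → 0ℚ ≤ M →
  - M ≤ s → s ≤ M → - M ≤ c → c ≤ M →
  a ≤ s → s ≤ b → b ≤ a + η → c ≤ t → t ≤ d → d ≤ c + η →
  a * c - (M * η + M * η) ≤ s * t × s * t ≤ a * c + (M * η + M * η)
product-bounds {M} {η} {a} {b} {c} {d} {s} {t} 0≤M -M≤s s≤M -M≤c c≤M a≤s s≤b b≤a+η c≤t t≤d d≤c+η =
  subst₂ _≤_ (cong (a * c +_) (sym (neg-distrib-+ (M * η) (M * η)))) split
    (+-monoʳ-≤ (a * c) (+-mono-≤ (proj₁ e₁) (proj₁ e₂))) ,
  subst (_≤ a * c + (M * η + M * η)) split
    (+-monoʳ-≤ (a * c) (+-mono-≤ (proj₂ e₁) (proj₂ e₂)))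
  where
  split : a * c + (s * (t - c) + c * (s - a)) ≡ s * t
  split = solve 4 (λ a c s t → a :* c :+ (s :* (t :- c) :+ c :* (s :- a)) := s :* t) refl a c s t

  diff : ∀ {u v w} → v ≤ w → w ≤ u + η → v - u ≤ η
  diff {u} {v} v≤w w≤u+η = subst (v - u ≤_)
    (solve 2 (λ u e → u :+ e :- u := e) refl u η) (+-monoˡ-≤ (- u) (≤-trans v≤w w≤u+η))

  e₁ = scaled-bound 0≤M -M≤s s≤M (0≤q-p c≤t) (diff t≤d d≤c+η)
  e₂ = scaled-bound 0≤M -M≤c c≤M (0≤q-p a≤s) (diff s≤b b≤a+η)

bound₂ : ∀ p q → ∃[ M ] 0ℚ < M × ∣ p ∣ ≤ M × ∣ q ∣ ≤ M
bound₂ p q = 1ℚ + (∣ p ∣ + ∣ q ∣) ,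
  <-≤-trans 0<1 (≤-by (∣ p ∣ + ∣ q ∣) (0≤+ (0≤∣p∣ p) (0≤∣p∣ q)) refl) ,
  ≤-by (1ℚ + ∣ q ∣) (0≤+ (<⇒≤ 0<1) (0≤∣p∣ q))
    (solve 2 (λ p q → p :+ (con 1ℚ :+ q) := con 1ℚ :+ (p :+ q)) refl (∣ p ∣) (∣ q ∣)) ,
  ≤-by (1ℚ + ∣ p ∣) (0≤+ (<⇒≤ 0<1) (0≤∣p∣ p))
    (solve 2 (λ p q → q :+ (con 1ℚ :+ p) := con 1ℚ :+ (p :+ q)) refl (∣ p ∣) (∣ q ∣))

*-cont : LocallyUniformlyContinuous _*_
*-cont x y {ε} 0<ε =
  let a₀ , La₀ = L-inhab x
      b₀ , Ub₀ = U-inhab x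
      c₀ , Lc₀ = L-inhab y
      d₀ , Ud₀ = U-inhab y
      M₁ , 0<M₁ , a₀≤M₁ , b₀≤M₁ = bound₂ a₀ b₀
      M₂ , 0<M₂ , c₀≤M₂ , d₀≤M₂ = bound₂ c₀ d₀
      M , 0<M , M₁≤M , M₂≤M = bound₂ M₁ M₂
      r , 0<r , rM≡1 = inverse 0<M
      0<η = 0<* (0<* 0<ε 0<½) 0<r
      a , b , La , Ub , a₀≤a , b≤b₀ , b≤a+η = approximateWithin x La₀ Ub₀ 0<η
      c , d , Lc , Ud , c₀≤c , d≤d₀ , d≤c+η = approximateWithin y Lc₀ Ud₀ 0<η
      M₁≤M′ = ≤-trans (proj₁ (∣∣-bounds M₁)) M₁≤M
      M₂≤M′ = ≤-trans (proj₁ (∣∣-bounds M₂)) M₂≤M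
  in record { Lx = La ; Ux = Ub ; Ly = Lc ; Uy = Ud } , a * c ,
     λ s t ((a≤s , s≤b) , (c≤t , t≤d)) →
       subst (λ e → a * c - e ≤ s * t × s * t ≤ a * c + e) (width M r rM≡1)
         (product-bounds (<⇒≤ 0<M)
           (below (≤-trans a₀≤M₁ M₁≤M′) (≤-trans a₀≤a a≤s))
           (above (≤-trans b₀≤M₁ M₁≤M′) (≤-trans s≤b b≤b₀))
           (below (≤-trans c₀≤M₂ M₂≤M′) c₀≤c)
           (above (≤-trans d₀≤M₂ M₂≤M′) (<⇒≤ (L<U y Lc Ud₀)))
           a≤s s≤b b≤a+η c≤t t≤d d≤c+η)
  where
  width : ∀ M r → r * M ≡ 1ℚ → M * (ε * ½ * r) + M * (ε * ½ * r) ≡ ε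
  width M r rM≡1 = trans
    (solve 3 (λ m e r → m :* (e :* con ½ :* r) :+ m :* (e :* con ½ :* r) := e :* (r :* m)) refl M ε r)
    (trans (cong (ε *_) rM≡1) (*-identityʳ ε))

  below : ∀ {A M s} → ∣ A ∣ ≤ M → A ≤ s → - M ≤ s
  below {A} A≤M A≤s = ≤-trans (neg-antimono-≤ A≤M) (≤-trans (proj₂ (∣∣-bounds A)) A≤s)

  above : ∀ {B M s} → ∣ B ∣ ≤ M → s ≤ B → s ≤ M
  above {B} B≤M s≤B = ≤-trans s≤B (≤-trans (proj₁ (∣∣-bounds B)) B≤M)

infixl 6 _+ᴿ_ _-ᴿ_
infixl 7 _*ᴿ_
infixr 8 _^ᴿ_
infix  9 -ᴿ_

_+ᴿ_ : ℝ → ℝ → ℝ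
_+ᴿ_ = lift₂ _+_ +-cont

_*ᴿ_ : ℝ → ℝ → ℝ
_*ᴿ_ = lift₂ _*_ *-cont

-ᴿ_ : ℝ → ℝ
-ᴿ x = record
  { L = λ p → U x (- p)
  ; U = λ p → L x (- p)
  ; L-inhab = let q , Uq = U-inhab x in - q , subst (U x) (sym (neg² q)) Uq
  ; U-inhab = let q , Lq = L-inhab x in - q , subst (L x) (sym (neg² q)) Lq
  ; L-down = λ p<q → U-up x (neg-antimono-< p<q)
  ; U-up = λ p<q → L-down x (neg-antimono-< p<q)
  ; L-open = λ {p} U-p → let q , q<-p , Uq = U-open x U-p in
      - q , subst (_< - q) (neg² p) (neg-antimono-< q<-p) , subst (U x) (sym (neg² q)) Uq
  ; U-open = λ {p} L-p → let q , -p<q , Lq = L-open x L-p in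
      - q , subst (- q <_) (neg² p) (neg-antimono-< -p<q) , subst (L x) (sym (neg² q)) Lq
  ; disjoint = λ U-p L-p → disjoint x L-p U-p
  ; located = λ p<q → swap (located x (neg-antimono-< p<q))
  }
  where
  neg² : ∀ p → - (- p) ≡ p
  neg² = solve 1 (λ p → :- (:- p) := p) refl

_-ᴿ_ : ℝ → ℝ → ℝ
x -ᴿ y = x +ᴿ -ᴿ y

_^ᴿ_ : ℝ → ℕ → ℝ
x ^ᴿ zero = 1ᴿ
x ^ᴿ suc n = x *ᴿ x ^ᴿ n

-- p < 1/x iff p < e for some e with e b ≤ 1, where b > x; dually above.
reciprocal : (x : ℝ) → 0ᴿ <ᴿ x → ℝ
reciprocal x (x₀ , 0<x₀ , Lx₀) = record
  { L = Lower
  ; U = Upper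
  ; L-inhab = let b , Ub = U-inhab x in
      0ℚ - 1ℚ , 0ℚ , <-by 1ℚ 0<1 refl , b , Ub , subst (_≤ 1ℚ) (sym (*-zeroˡ b)) (<⇒≤ 0<1)
  ; U-inhab = let r , 0<r , rx₀≡1 = inverse 0<x₀ in
      r + 1ℚ , r , <-by 1ℚ 0<1 refl , x₀ , Lx₀ , 0<x₀ , ≤-reflexive (sym rx₀≡1)
  ; L-down = λ p<q (e , q<e , ub) → e , <-trans p<q q<e , ub
  ; U-up = λ p<q (e , e<p , lb) → e , <-trans e<p p<q , lb
  ; L-open = λ (e , p<e , ub) → let m , p<m , m<e = <-dense p<e in m , p<m , e , m<e , ub
  ; U-open = λ (e , e<p , lb) → let m , e<m , m<p = <-dense e<p in m , m<p , e , e<m , lb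
  ; disjoint = λ (e , p<e , b , Ub , eb≤1) (e′ , e′<p , a , La , 0<a , 1≤e′a) →
      let a<b = L<U x La Ub
          0<b = <-trans 0<a a<b
          0<e′ = *-cancelʳ-<-nonNeg a {{pos⇒nonNeg a {{positive 0<a}}}} {0ℚ} {e′}
                   (subst (_< e′ * a) (sym (*-zeroˡ a)) (<-≤-trans 0<1 1≤e′a))
      in <-irrefl refl (<-≤-trans (≤-<-trans 1≤e′a (<-trans
           (*-monoʳ-<-pos e′ {{positive 0<e′}} a<b)
           (*-monoˡ-<-pos b {{positive 0<b}} (<-trans e′<p p<e)))) eb≤1)
  ; located = loc
  }
  where
  Lower Upper : ℚ → Set
  Lower p = ∃[ e ] p < e × ∃[ b ] U x b × e * b ≤ 1ℚ
  Upper p = ∃[ e ] e < p × ∃[ a ] L x a × 0ℚ < a × 1ℚ ≤ e * a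

  loc : ∀ {p q} → p < q → Lower p ⊎ Upper q
  loc {p} {q} p<q
    with e , p<e , e<q ← <-dense p<q
    with f , e<f , f<q ← <-dense e<q
    with 0ℚ <? e
  ... | no e≤0 = let b , Ub = U-inhab x
                     0<b = <-trans 0<x₀ (L<U x Lx₀ Ub) in
    inj₁ (e , p<e , b , Ub , ≤-trans
      (subst (e * b ≤_) (*-zeroˡ b) (*-monoʳ-≤-nonNeg b {{nonNegative (<⇒≤ 0<b)}} (≮⇒≥ e≤0)))
      (<⇒≤ 0<1))
  ... | yes 0<e
    with r , 0<r , re≡1 ← inverse 0<e
    with s , 0<s , sf≡1 ← inverse (<-trans 0<e e<f)
    with located x (*-cancelʳ-<-nonNeg e {{pos⇒nonNeg e {{positive 0<e}}}}
           (<-≤-trans (*-monoʳ-<-pos s {{positive 0<s}} e<f)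
             (≤-reflexive (trans sf≡1 (sym re≡1)))))
  ...   | inj₁ Ls = inj₂ (f , f<q , s , Ls , 0<s , ≤-reflexive (trans (sym sf≡1) (*-comm s f)))
  ...   | inj₂ Ur = inj₁ (e , p<e , r , Ur , ≤-reflexive (trans (*-comm e r) re≡1))

divide : (x y : ℝ) → 0ᴿ <ᴿ y → ℝ
divide x y 0<y = x *ᴿ reciprocal y 0<y

0<*ᴿ : ∀ x y → 0ᴿ <ᴿ x → 0ᴿ <ᴿ y → 0ᴿ <ᴿ x *ᴿ y
0<*ᴿ x y (a , 0<a , La) (c , 0<c , Lc) =
  let b , Ub = U-inhab x
      d , Ud = U-inhab y
      p , 0<p , p<ac = <-dense (0<* 0<a 0<c)
  in p , 0<p , a * c , p<ac , record { Lx = La ; Ux = Ub ; Ly = Lc ; Uy = Ud } ,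
     λ s t ((a≤s , _) , (c≤t , _)) → *-mono-0≤ (<⇒≤ 0<a) a≤s (<⇒≤ 0<c) c≤t

0<reciprocal : ∀ x (0<x : 0ᴿ <ᴿ x) → 0ᴿ <ᴿ reciprocal x 0<x
0<reciprocal x (a , 0<a , La) =
  let b , Ub = U-inhab x
      r , 0<r , rb≡1 = inverse (<-trans 0<a (L<U x La Ub))
      p , 0<p , p<r = <-dense 0<r
  in p , 0<p , r , p<r , b , Ub , ≤-reflexive rb≡1

0<divide : ∀ x y → 0ᴿ <ᴿ x → (0<y : 0ᴿ <ᴿ y) → 0ᴿ <ᴿ divide x y 0<y
0<divide x y 0<x 0<y = 0<*ᴿ x (reciprocal y 0<y) 0<x (0<reciprocal y 0<y)

1<x⇒0<x : ∀ x → 1ᴿ <ᴿ x → 0ᴿ <ᴿ x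
1<x⇒0<x x (a , 1<a , La) = a , <-trans 0<1 1<a , La

1<x⇒0<x-1 : ∀ x → 1ᴿ <ᴿ x → 0ᴿ <ᴿ x -ᴿ 1ᴿ
1<x⇒0<x-1 x (a , 1<a , La) =
  let b , Ub = U-inhab x
      p , 0<p , p<η = <-dense 0<η
  in p , 0<p , η , p<η ,
     record { y₂ = 0ℚ ; Lx = La ; Ux = Ub ; Ly = <-by η 0<η below ; Uy = 0<1 } ,
     λ s t ((a≤s , _) , (c≤t , _)) → subst (_≤ s + t) eq (+-mono-≤ a≤s c≤t)
  where
  η = (a - 1ℚ) * ½
  0<η = 0<* (0<q-p 1<a) 0<½
  below : 1ℚ + η ≡ - (- (1ℚ + η))
  below = solve 1 (λ e → con 1ℚ :+ e := :- (:- (con 1ℚ :+ e))) refl η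
  eq : a + - (1ℚ + η) ≡ η
  eq = solve 1 (λ a → a :+ :- (con 1ℚ :+ (a :- con 1ℚ) :* con ½) := (a :- con 1ℚ) :* con ½) refl a

-- 2^ e ≤ℚ c and c ≤ℚ2^ e are 2ᵉ ≤ c and c ≤ 2ᵉ for
-- rational e, cleared of fractional and negative exponents by writing
-- e = (m - k) / (b + 1).

2^_≤ℚ_ : ℚ → ℚ → Set
2^ e ≤ℚ c = ∃[ m ] ∃[ k ] ∃[ b ] e * ι (suc b) + ι k ≡ ι m × 2ℚ ^ m ≤ 2ℚ ^ k * c ^ suc b

_≤ℚ2^_ : ℚ → ℚ → Set
c ≤ℚ2^ e = ∃[ m ] ∃[ k ] ∃[ b ] e * ι (suc b) + ι k ≡ ι m × 2ℚ ^ k * c ^ suc b ≤ 2ℚ ^ m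

2^-reflects-≤ : ∀ {e e′ c c′} → 0ℚ < c → c ≤ c′ → 2^ e ≤ℚ c → c′ ≤ℚ2^ e′ → e ≤ e′
2^-reflects-≤ {e} {e′} {c} {c′} 0<c c≤c′ (m , k , b , e≡ , lo) (m′ , k′ , b′ , e′≡ , hi) =
  ≮⇒≥ λ e′<e → <-irrefl refl (<-≤-trans
    (*-monoˡ-<-pos X′ {{positive 0<X′}} (2^-mono-< (exponents e′<e)))
    (subst₂ _≤_ (cong (_* X′) (sym (^-homo-* 2ℚ (m ℕ.* B′) (k′ ℕ.* B))))
                (cong (_* X′) (sym (^-homo-* 2ℚ (k ℕ.* B′) (m′ ℕ.* B)))) powers))
  where
  B = suc b
  B′ = suc b′
  X = c ^ (B ℕ.* B′)
  X′ = c′ ^ (B ℕ.* B′)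
  P = 2ℚ ^ (m ℕ.* B′)
  Q = 2ℚ ^ (k′ ℕ.* B)
  R = 2ℚ ^ (k ℕ.* B′)
  S = 2ℚ ^ (m′ ℕ.* B)

  0<X′ : 0ℚ < X′
  0<X′ = 0<^ (B ℕ.* B′) (<-≤-trans 0<c c≤c′)

  0≤2^ : ∀ n → 0ℚ ≤ 2ℚ ^ n
  0≤2^ n = 0≤^ n (<⇒≤ 0<2)

  exponents : e′ < e → k ℕ.* B′ ℕ.+ m′ ℕ.* B ℕ.< m ℕ.* B′ ℕ.+ k′ ℕ.* B
  exponents e′<e = ι-cancel-< (subst₂ _<_
    (trans (cong (ι k * ι B′ +_) (cong (_* ι B) e′≡)) (hom k m′))
    (trans (trans
      (solve 5 (λ e x y k k′ → k :* y :+ (e :* y :+ k′) :* x := (e :* x :+ k) :* y :+ k′ :* x)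
        refl e (ι B) (ι B′) (ι k) (ι k′))
      (cong (λ z → z * ι B′ + ι k′ * ι B) e≡)) (hom m k′))
    (+-monoʳ-< (ι k * ι B′) (*-monoˡ-<-pos (ι B) {{ιB⁺ b}} (+-monoˡ-< (ι k′)
      (*-monoˡ-<-pos (ι B′) {{ιB⁺ b′}} e′<e)))))
    where
    ιB⁺ : ∀ n → Positive (ι (suc n))
    ιB⁺ n = positive (<-≤-trans 0<1 (1≤ι-suc n))
    hom : ∀ u v → ι u * ι B′ + ι v * ι B ≡ ι (u ℕ.* B′ ℕ.+ v ℕ.* B)
    hom u v = trans (cong₂ _+_ (sym (ι-* u B′)) (sym (ι-* v B)))
      (sym (ι-+ (u ℕ.* B′) (v ℕ.* B)))

  lo′ : P ≤ R * X
  lo′ = subst₂ _≤_ (^-assocʳ 2ℚ m B′)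
    (trans (^-distrib-* (2ℚ ^ k) (c ^ B) B′) (cong₂ _*_ (^-assocʳ 2ℚ k B′) (^-assocʳ c B B′)))
    (^-mono-≤ B′ (0≤2^ m) lo)

  hi′ : Q * X′ ≤ S
  hi′ = subst₂ _≤_
    (trans (^-distrib-* (2ℚ ^ k′) (c′ ^ B′) B) (cong₂ _*_ (^-assocʳ 2ℚ k′ B)
      (trans (^-assocʳ c′ B′ B) (cong (c′ ^_) (ℕₚ.*-comm B′ B)))))
    (^-assocʳ 2ℚ m′ B)
    (^-mono-≤ B (0≤* (0≤2^ k′) (0≤^ B′ (<⇒≤ (<-≤-trans 0<c c≤c′)))) hi)

  powers : P * Q * X′ ≤ R * S * X′
  powers = ≤-trans (≤-reflexive (*-assoc P Q X′)) (≤-trans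
    (*-mono-0≤ (0≤2^ (m ℕ.* B′))
      (≤-trans lo′ (*-monoˡ-≤-nonNeg R {{nonNegative (0≤2^ (k ℕ.* B′))}}
        (^-mono-≤ (B ℕ.* B′) (<⇒≤ 0<c) c≤c′)))
      (0≤* (0≤2^ (k′ ℕ.* B)) (<⇒≤ 0<X′)) hi′)
    (≤-reflexive (solve 3 (λ r s x → r :* x :* s := r :* s :* x) refl R S X′)))

-- (b + 1)-th powers of sufficiently close positive rationals differ by at
-- most a factor of 2.
closePowers : ∀ b → ∃[ δ ] 0ℚ < δ ×
  (∀ {c c′} → 0ℚ < c → c ≤ c′ → c′ ≤ c + c * δ → c′ ^ suc b ≤ 2ℚ * c ^ suc b)
closePowers b = δ , 0<δ , close
  where
  B = suc b
  inv = inverse (<-≤-trans 0<1 (1≤ι-suc b))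
  δ = ½ * proj₁ inv

  0<δ : 0ℚ < δ
  0<δ = 0<* 0<½ (proj₁ (proj₂ inv))

  Bδ≡½ : ι B * δ ≡ ½
  Bδ≡½ = trans (solve 2 (λ x r → x :* (con ½ :* r) := con ½ :* (r :* x)) refl (ι B) (proj₁ inv))
    (trans (cong (½ *_) (proj₂ (proj₂ inv))) (*-identityʳ ½))

  δ≤1 : δ ≤ 1ℚ
  δ≤1 = ≤-trans (subst₂ _≤_ (*-identityˡ δ) Bδ≡½
      (*-monoʳ-≤-nonNeg δ {{nonNegative (<⇒≤ 0<δ)}} (1≤ι-suc b)))
    (≤-by ½ (<⇒≤ 0<½) refl)

  ½≤ : ½ ≤ (1ℚ - δ) ^ B
  ½≤ = subst (_≤ (1ℚ - δ) ^ B) (cong (λ z → 1ℚ - z) Bδ≡½) (bernoulli B (<⇒≤ 0<δ) δ≤1)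

  close : ∀ {c c′} → 0ℚ < c → c ≤ c′ → c′ ≤ c + c * δ → c′ ^ B ≤ 2ℚ * c ^ B
  close {c} {c′} 0<c c≤c′ c′≤ = subst (_≤ 2ℚ * c ^ B)
    (trans (sym (*-assoc 2ℚ ½ (c′ ^ B))) (*-identityˡ (c′ ^ B)))
    (*-monoˡ-≤-nonNeg 2ℚ (≤-trans
      (*-monoʳ-≤-nonNeg (c′ ^ B) {{nonNegative (0≤^ B 0≤c′)}} ½≤)
      (subst (_≤ c ^ B) (^-distrib-* (1ℚ - δ) c′ B)
        (^-mono-≤ B (0≤* (0≤q-p δ≤1) 0≤c′) shrunk))))
    where
    0≤c′ = <⇒≤ (<-≤-trans 0<c c≤c′)
    shrunk : (1ℚ - δ) * c′ ≤ c
    shrunk = ≤-trans (*-monoˡ-≤-nonNeg (1ℚ - δ) {{nonNegative (0≤q-p δ≤1)}} c′≤)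
      (≤-by (c * (δ * δ)) (0≤* (<⇒≤ 0<c) (0≤* (<⇒≤ 0<δ) (<⇒≤ 0<δ)))
        (solve 2 (λ c d → (con 1ℚ :- d) :* (c :+ c :* d) :+ c :* (d :* d) := c) refl c δ))

-- p < log₂ y iff p < e for some e with 2ᵉ ≤ c < y, where c > 0; dually above.
log₂ : (y : ℝ) → 0ᴿ <ᴿ y → ℝ
log₂ y (y₀ , 0<y₀ , Ly₀) = record
  { L = Lower
  ; U = Upper
  ; L-inhab = let k , 1<ky₀ = archimedean 1ℚ 0<y₀ in
      - ι k - 1ℚ , - ι k ,
      <-by 1ℚ 0<1 (solve 1 (λ k → :- k :- con 1ℚ :+ con 1ℚ := :- k) refl (ι k)) ,
      y₀ , Ly₀ , 0<y₀ , zero , k , zero ,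
      trans (cong (_+ ι k) (*-identityʳ (- ι k))) (+-inverseˡ (ι k)) ,
      ≤-trans (<⇒≤ 1<ky₀) (subst (λ z → ι k * y₀ ≤ 2ℚ ^ k * z) (sym (*-identityʳ y₀))
        (*-monoʳ-≤-nonNeg y₀ {{nonNegative (<⇒≤ 0<y₀)}}
          (≤-trans (ι-mono-≤ (ℕₚ.n≤1+n k)) (ι≤2^ k))))
  ; U-inhab = let c , Uc = U-inhab y
                  m , c<m = ι-bound c in
      ι m + 1ℚ , ι m , <-by 1ℚ 0<1 refl , c , Uc , m , zero , zero ,
      trans (cong (_+ 0ℚ) (*-identityʳ (ι m))) (+-identityʳ (ι m)) ,
      subst (_≤ 2ℚ ^ m) (sym (trans (*-identityˡ (c * 1ℚ)) (*-identityʳ c)))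
        (≤-trans (<⇒≤ c<m) (≤-trans (ι-mono-≤ (ℕₚ.n≤1+n m)) (ι≤2^ m)))
  ; L-down = λ p<q (e , q<e , w) → e , <-trans p<q q<e , w
  ; U-up = λ p<q (e , e<p , w) → e , <-trans e<p p<q , w
  ; L-open = λ (e , p<e , w) → let m , p<m , m<e = <-dense p<e in m , p<m , e , m<e , w
  ; U-open = λ (e , e<p , w) → let m , e<m , m<p = <-dense e<p in m , m<p , e , e<m , w
  ; disjoint = λ (e , p<e , c , Lc , 0<c , lo) (e′ , e′<p , c′ , Uc′ , hi) →
      <-irrefl refl (<-≤-trans (<-trans e′<p p<e)
        (2^-reflects-≤ 0<c (<⇒≤ (L<U y Lc Uc′)) lo hi))
  ; located = loc
  }
  where
  Lower Upper : ℚ → Set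
  Lower p = ∃[ e ] p < e × ∃[ c ] L y c × 0ℚ < c × 2^ e ≤ℚ c
  Upper p = ∃[ e ] e < p × ∃[ c ] U y c × c ≤ℚ2^ e

  module Fraction (b : ℕ) where
    B = suc b
    inv = inverse (<-≤-trans 0<1 (1≤ι-suc b))

    _÷B : ℚ → ℚ
    n ÷B = n * proj₁ inv

    ÷B-*B : ∀ n → n ÷B * ι B ≡ n
    ÷B-*B n = trans (*-assoc n (proj₁ inv) (ι B))
      (trans (cong (n *_) (proj₂ (proj₂ inv))) (*-identityʳ n))

    fraction : ∀ m k → (m - k) ÷B * ι B + k ≡ m
    fraction m k = trans (cong (_+ k) (÷B-*B (m - k)))
      (solve 2 (λ m k → m :- k :+ k := m) refl m k)

    ÷B-lower : ∀ {p m k} → p * ι B + k < m → p < (m - k) ÷B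
    ÷B-lower {p} {m} {k} lt = *-cancelʳ-<-nonNeg (ι B) {{nonNegative (0≤ι B)}}
      (subst₂ _<_ (solve 2 (λ p k → p :+ k :- k := p) refl (p * ι B) k) (sym (÷B-*B (m - k)))
        (+-monoˡ-< (- k) lt))

    ÷B-upper : ∀ {p m k} → m < p * ι B + k → (m - k) ÷B < p
    ÷B-upper {p} {m} {k} lt = *-cancelʳ-<-nonNeg (ι B) {{nonNegative (0≤ι B)}}
      (subst₂ _<_ (sym (÷B-*B (m - k))) (solve 2 (λ p k → p :+ k :- k := p) refl (p * ι B) k)
        (+-monoˡ-< (- k) lt))

  locateWith : ∀ {p q} b m k → p * ι (suc b) + ι k < ι m → ι (suc m) < q * ι (suc b) + ι k →
    Lower p ⊎ Upper q
  locateWith {p} {q} b m k p< <q = decide (approximateWithin y Ly₀ (proj₂ (U-inhab y)) 0<η)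
    where
    open Fraction b
    δ = proj₁ (closePowers b)
    η = y₀ * δ
    0<η : 0ℚ < η
    0<η = 0<* 0<y₀ (proj₁ (proj₂ (closePowers b)))

    decide : ∃[ c ] ∃[ c′ ] L y c × U y c′ × y₀ ≤ c × c′ ≤ proj₁ (U-inhab y) × c′ ≤ c + η →
      Lower p ⊎ Upper q
    decide (c , c′ , Lc , Uc′ , y₀≤c , _ , c′≤c+η) = case (≤-total (2ℚ ^ m) (2ℚ ^ k * c ^ B))
      where
      case : 2ℚ ^ m ≤ 2ℚ ^ k * c ^ B ⊎ 2ℚ ^ k * c ^ B ≤ 2ℚ ^ m → Lower p ⊎ Upper q
      case (inj₁ 2^m≤) = inj₁ ((ι m - ι k) ÷B , ÷B-lower p< , c , Lc , <-≤-trans 0<y₀ y₀≤c ,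
            m , k , b , fraction (ι m) (ι k) , 2^m≤)
      case (inj₂ ≤2^m) = inj₂ ((ι (suc m) - ι k) ÷B , ÷B-upper <q , c′ , Uc′ ,
            suc m , k , b , fraction (ι (suc m)) (ι k) , ≤-trans
              (*-monoˡ-≤-nonNeg (2ℚ ^ k) {{nonNegative (0≤^ k (<⇒≤ 0<2))}}
                (proj₂ (proj₂ (closePowers b)) (<-≤-trans 0<y₀ y₀≤c) (<⇒≤ (L<U y Lc Uc′))
                  (≤-trans c′≤c+η (+-monoʳ-≤ c (*-monoʳ-≤-nonNeg δ
                    {{nonNegative (<⇒≤ (proj₁ (proj₂ (closePowers b))))}} y₀≤c)))))
              (subst (_≤ 2ℚ * 2ℚ ^ m)
                (solve 2 (λ u v → con 2ℚ :* (u :* v) := u :* (con 2ℚ :* v)) refl (2ℚ ^ k) (c ^ B))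
                (*-monoˡ-≤-nonNeg 2ℚ ≤2^m)))

  loc : ∀ {p q} → p < q → Lower p ⊎ Upper q
  loc {p} {q} p<q = case (archimedean 2ℚ (0<q-p p<q))
    where
    case : ∃[ n ] 2ℚ < ι n * (q - p) → Lower p ⊎ Upper q
    case (zero , 2<0) = ⊥-elim (<-asym 0<2 (subst (2ℚ <_) (*-zeroˡ (q - p)) 2<0))
    case (suc b , 2<B[q-p]) =
      let k , -pB<k = ι-bound (- (p * ι (suc b)))
          m , t<m , m≤t+1 = natCeiling (<⇒≤ (subst (_< p * ι (suc b) + ι k)
            (+-inverseʳ (p * ι (suc b))) (+-monoʳ-< (p * ι (suc b)) -pB<k)))
      in locateWith b m k t<m (≤-<-trans
           (subst₂ _≤_ (sym (ι-suc m))
             (solve 1 (λ t → con 1ℚ :+ (t :+ con 1ℚ) := t :+ con 2ℚ) refl (p * ι (suc b) + ι k))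
             (+-monoʳ-≤ 1ℚ m≤t+1))
           (subst (p * ι (suc b) + ι k + 2ℚ <_)
             (solve 4 (λ p q n k → p :* n :+ k :+ n :* (q :- p) := q :* n :+ k)
               refl p q (ι (suc b)) (ι k))
             (+-monoʳ-< (p * ι (suc b) + ι k) 2<B[q-p])))

0<x/[x-1] : ∀ x (1<x : 1ᴿ <ᴿ x) → 0ᴿ <ᴿ divide x (x -ᴿ 1ᴿ) (1<x⇒0<x-1 x 1<x)
0<x/[x-1] x 1<x = 0<divide x (x -ᴿ 1ᴿ) (1<x⇒0<x x 1<x) (1<x⇒0<x-1 x 1<x)

-- Big O at infinity, for nonnegative functions.
infix 4 _∈O_

_∈O_ : (ℕ → ℝ) → (ℕ → ℝ) → Set₁
f ∈O g = ∃[ C ] 0ᴿ <ᴿ C × ∃[ N ] (∀ n → N ℕ.≤ n → f n ≤ᴿ C *ᴿ g n)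

powerSum : ℝ → ℕ → ℝ
powerSum α zero = α ^ᴿ zero
powerSum α (suc i) = powerSum α i +ᴿ α ^ᴿ suc i

-- The ceiling of a real is unique but not computable, hence a relation.
IsCeiling : ℝ → ℕ → Set
IsCeiling x n = x ≤ᴿ fromℕ n × fromℕ n <ᴿ x +ᴿ 1ᴿ

IsPivots : ℝ → (ℕ → ℕ) → Set
IsPivots α p = ∀ i → IsCeiling (powerSum α i) (p i)

module _ (p : ℕ → ℕ) where

  -- For α > 1 the pivots are strictly increasing from p 0 = 1, so i < p i:
  -- distinct indices give distinct pivots, and indices i ≥ e give none below e.
  pivotCount : ℕ → ℕ → ℕ
  pivotCount s e = length (filter (λ i → s ℕₚ.<? p i ×-dec p i ℕₚ.<? e) (upTo e))

  IsPivotBetween : ℕ → ℕ → ℕ → Set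
  IsPivotBetween s e v = ∃[ i ] v ≡ p i × s ℕ.< v × v ℕ.< e

  -- x s e is a pivot strictly between s and e at least distance from
  -- (s + e) / 2; distances are doubled, and ties are broken arbitrarily.
  IsClosestPivot : (ℕ → ℕ → ℕ) → Set
  IsClosestPivot x = ∀ s e → pivotCount s e ≢ 0 →
    IsPivotBetween s e (x s e) ×
    (∀ v → IsPivotBetween s e v →
      ℕ.∣ 2 ℕ.* x s e - s ℕ.+ e ∣ ℕ.≤ ℕ.∣ 2 ℕ.* v - s ℕ.+ e ∣)

  -- The recurrence determines r: both recursive calls are on shorter ranges.
  record IsRuntime (x r : ℕ → ℕ → ℕ) : Set where
    field
      stop  : ∀ s e → e ℕ.≤ s ⊎ pivotCount s e ≡ 0 → r s e ≡ 0
      split : ∀ s e → s ℕ.< e → pivotCount s e ≢ 0 →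
        r s e ≡ (e ℕ.∸ s) ℕ.+ r s (x s e ℕ.∸ 1) ℕ.+ r (x s e ℕ.+ 1) e

{-# OPTIONS --safe #-}
module Submission where

-- For fixed α > 1 the factor log (α / (α - 1)) is a positive constant, so a
-- linear bound on r 0 n suffices. If the pivot p i is closest to the center of
-- (s , e), then e ≤ 2 p (i + 1), for otherwise p (i + 1) would be closer; hence
-- partitioning on p i costs at most a constant times p i. Each pivot is used
-- at most once, and the pivots grow geometrically, so the pivots below n sum to
-- a constant times n.

open import Defs
open import Algebra.Bundles using (CommutativeRing)
open import Data.Empty using (⊥-elim)
open import Data.Nat.Base as ℕ using (ℕ; zero; suc)
import Data.Nat.Properties as ℕₚ
import Data.Nat.Solver as ℕ-Solver
open import Data.Product.Base using (∃-syntax; _×_; _,_; proj₁; proj₂)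
open import Data.Sum.Base using (inj₂)
open import Relation.Binary.PropositionalEquality
  using (_≡_; _≢_; refl; sym; trans; cong; subst; subst₂)
open import Relation.Nullary.Decidable using (yes; no)

-- Runtime bound for geometrically growing natural-number pivots.

module GeometricPivots (p : ℕ → ℕ) (c M : ℕ)
  (0<p₀ : 0 ℕ.< p 0)
  (p-increasing : ∀ i → p i ℕ.< p (suc i))
  (p-growth-≤ : ∀ i → p (suc i) ℕ.≤ M ℕ.* p i)
  -- p (i + 1) - 1 ≥ (1 + 1/c) (p i - 1), free of subtraction
  (p-growth-≥ : ∀ i → suc c ℕ.* p i ℕ.≤ c ℕ.* p (suc i) ℕ.+ 1)
  where

  open import Data.Nat.Base
  open ℕₚ
  open ≤-Reasoning hiding (stop)
  open ℕ-Solver.+-*-Solver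

  p-monotone : ∀ {i j} → i ≤ j → p i ≤ p j
  p-monotone {i} {j} i≤j = go (≤⇒≤′ i≤j)
    where
    go : ∀ {j} → i ≤′ j → p i ≤ p j
    go ≤′-refl = ≤-refl
    go (≤′-step i≤j) = ≤-trans (go i≤j) (<⇒≤ (p-increasing _))

  p-cancel-< : ∀ {i j} → p i < p j → i < j
  p-cancel-< p<p = ≰⇒> λ j≤i → <⇒≱ p<p (p-monotone j≤i)

  i<p : ∀ i → i < p i
  i<p zero = 0<p₀
  i<p (suc i) = ≤-<-trans (i<p i) (p-increasing i)

  prefixSum : ℕ → ℕ
  prefixSum zero = 0
  prefixSum (suc j) = prefixSum j + p j

  prefixSum-mono : ∀ {i j} → i ≤ j → prefixSum i ≤ prefixSum j
  prefixSum-mono {i} {j} i≤j = go (≤⇒≤′ i≤j)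
    where
    go : ∀ {j} → i ≤′ j → prefixSum i ≤ prefixSum j
    go ≤′-refl = ≤-refl
    go (≤′-step i≤j) = ≤-trans (go i≤j) (m≤m+n _ _)

  -- The growth condition trades `suc c * p j` for `c * p (suc j) + 1`, which leaves room for the
  -- new summand `p (suc j)`. The stray `+ 1` of each step accumulates to the term `suc j`.
  prefixSum-bound : ∀ j → prefixSum (suc j) ≤ suc c * p j + suc j
  prefixSum-bound zero = ≤-trans (m≤m+n (p 0) (c * p 0)) (m≤m+n _ 1)
  prefixSum-bound (suc j) = begin
    prefixSum (suc j) + p (suc j)             ≤⟨ +-monoˡ-≤ (p (suc j)) (prefixSum-bound j) ⟩
    suc c * p j + suc j + p (suc j)           ≤⟨ +-monoˡ-≤ (p (suc j)) (+-monoˡ-≤ (suc j) (p-growth-≥ j)) ⟩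
    c * p (suc j) + 1 + suc j + p (suc j)     ≡⟨ solve 3 (λ u v j → u :+ con 1 :+ j :+ v := v :+ u :+ (con 1 :+ j))
                                                   refl (c * p (suc j)) (p (suc j)) (suc j) ⟩
    suc c * p (suc j) + suc (suc j)           ∎

  -- The search descends from `n` to the least `b` with `n ≤ p b`, so the last summand lies below
  -- `n`. The linear term of `prefixSum-bound` is absorbed because `i < p i`.
  pivotsBelow : ∀ n → ∃[ b ] n ≤ p b × prefixSum b ≤ (suc c + 1) * n
  pivotsBelow n = search n (<⇒≤ (i<p n))
    where
    search : ∀ b → n ≤ p b → ∃[ b ] n ≤ p b × prefixSum b ≤ (suc c + 1) * n
    search zero n≤p = 0 , n≤p , z≤n
    search (suc b) n≤p with n ≤? p b
    ... | yes n≤pb = search b n≤pb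
    ... | no n≰pb = suc b , n≤p , (begin
      prefixSum (suc b)        ≤⟨ prefixSum-bound b ⟩
      suc c * p b + suc b      ≤⟨ +-mono-≤ (*-monoʳ-≤ (suc c) pb≤n) (≤-trans (i<p b) pb≤n) ⟩
      suc c * n + n            ≡⟨ solve 2 (λ c n → c :* n :+ n := (c :+ con 1) :* n) refl (suc c) n ⟩
      (suc c + 1) * n          ∎)
      where pb≤n = <⇒≤ (≰⇒> n≰pb)

  -- Charging each partitioning step to its pivot.

  module _ (x r : ℕ → ℕ → ℕ) (closest : IsClosestPivot p x) (runtime : IsRuntime p x r) where

    open IsRuntime runtime

    -- Otherwise p (i + 1) would lie in the left half of the range, closer to its center.
    rangeEnd-bound : ∀ {s e i} → pivotCount p s e ≢ 0 → x s e ≡ p i → s < p i →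
      e ≤ 2 * p (suc i)
    rangeEnd-bound {s} {e} {i} count≢0 x≡p s<p = ≮⇒≥ λ 2p′<e →
      let p′ = p (suc i)
          2p<2p′ = *-monoʳ-< 2 (p-increasing i)
          2p′≤s+e = ≤-trans (<⇒≤ 2p′<e) (m≤n+m e s)
          nearer = proj₂ (closest s e count≢0) p′
            (suc i , refl , <-trans s<p (p-increasing i) , ≤-<-trans (m≤m+n p′ _) 2p′<e)
      in <⇒≱ (∸-monoʳ-< 2p<2p′ 2p′≤s+e) (subst₂ _≤_
           (trans (cong (λ v → ∣ 2 * v - s + e ∣) x≡p)
             (m≤n⇒∣m-n∣≡n∸m (≤-trans (<⇒≤ 2p<2p′) 2p′≤s+e)))
           (m≤n⇒∣m-n∣≡n∸m 2p′≤s+e) nearer)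

    rangeFactor : ℕ
    rangeFactor = 2 * M

    rangeLength-bound : ∀ {s e i} → pivotCount p s e ≢ 0 → x s e ≡ p i → s < p i →
      e ∸ s ≤ rangeFactor * p i
    rangeLength-bound {s} {e} {i} count≢0 x≡p s<p = begin
      e ∸ s            ≤⟨ m∸n≤m e s ⟩
      e                ≤⟨ rangeEnd-bound count≢0 x≡p s<p ⟩
      2 * p (suc i)    ≤⟨ *-monoʳ-≤ 2 (p-growth-≤ i) ⟩
      2 * (M * p i)    ≡⟨ *-assoc 2 M (p i) ⟨
      2 * M * p i      ∎

    -- The indices from `a` up to but excluding `b` cover all pivots inside the range, and the claim
    -- bounds the cost by their sum, free of subtraction. Partitioning on `p i` is charged to `p i`;
    -- the left part keeps the indices below `i`, the right part those above, so no index is charged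
    -- twice. `fuel` bounds `b - a`, as the recurrence is not structural.
    runtime-bound : ∀ fuel {s e a b} → a ≤ b → b ≤ fuel + a →
      (∀ i → s < p i → a ≤ i) → (∀ i → p i < e → i < b) →
      r s e + rangeFactor * prefixSum a ≤ rangeFactor * prefixSum b
    runtime-bound fuel {s} {e} {a} {b} a≤b b≤fuel+a lo hi with pivotCount p s e ≟ 0
    ... | yes count≡0 = subst (λ z → z + rangeFactor * prefixSum a ≤ rangeFactor * prefixSum b)
            (sym (stop s e (inj₂ count≡0))) (*-monoʳ-≤ rangeFactor (prefixSum-mono a≤b))
    ... | no count≢0 with proj₁ (closest s e count≢0)
    ...   | i , x≡p , s<x , x<e = divideAt fuel b≤fuel+a
      where
      s<p = subst (s <_) x≡p s<x
      p<e = subst (_< e) x≡p x<e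
      a≤i = lo i s<p
      i<b = hi i p<e

      divideAt : ∀ fuel → b ≤ fuel + a → r s e + rangeFactor * prefixSum a ≤ rangeFactor * prefixSum b
      -- Without fuel no index is left, yet `i` is one.
      divideAt zero b≤a = ⊥-elim (<⇒≱ i<b (≤-trans b≤a a≤i))
      divideAt (suc fuel) b≤ = begin
        r s e + rangeFactor * prefixSum a
          ≡⟨ cong (_+ rangeFactor * prefixSum a) (split s e (<-trans s<x x<e) count≢0) ⟩
        e ∸ s + r s (x s e ∸ 1) + r (x s e + 1) e + rangeFactor * prefixSum a
          ≡⟨ cong (λ v → e ∸ s + r s (v ∸ 1) + r (v + 1) e + rangeFactor * prefixSum a) x≡p ⟩
        e ∸ s + r s (p i ∸ 1) + r (p i + 1) e + rangeFactor * prefixSum a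
          ≡⟨ solve 4 (λ u v w z → u :+ v :+ w :+ z := v :+ z :+ u :+ w) refl
               (e ∸ s) (r s (p i ∸ 1)) (r (p i + 1) e) (rangeFactor * prefixSum a) ⟩
        r s (p i ∸ 1) + rangeFactor * prefixSum a + (e ∸ s) + r (p i + 1) e
          ≤⟨ +-monoˡ-≤ (r (p i + 1) e) (+-mono-≤ left (rangeLength-bound count≢0 x≡p s<p)) ⟩
        rangeFactor * prefixSum i + rangeFactor * p i + r (p i + 1) e
          ≡⟨ cong (_+ r (p i + 1) e) (*-distribˡ-+ rangeFactor (prefixSum i) (p i)) ⟨
        rangeFactor * prefixSum (suc i) + r (p i + 1) e
          ≡⟨ +-comm (rangeFactor * prefixSum (suc i)) _ ⟩
        r (p i + 1) e + rangeFactor * prefixSum (suc i)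
          ≤⟨ right ⟩
        rangeFactor * prefixSum b ∎
        where
        left = runtime-bound fuel a≤i (≤-pred (≤-trans i<b b≤)) lo
          (λ k pk< → p-cancel-< (<-≤-trans pk< (m∸n≤m (p i) 1)))
        right = runtime-bound fuel i<b
          (≤-trans b≤ (≤-trans (+-monoʳ-≤ (suc fuel) a≤i) (≤-reflexive (sym (+-suc fuel i)))))
          (λ k <pk → p-cancel-< (≤-<-trans (m≤m+n (p i) 1) <pk)) hi

    runtime-linear : ∀ n → r 0 n ≤ rangeFactor * (suc c + 1) * n
    runtime-linear n = let b , n≤p , sum≤ = pivotsBelow n in begin
      r 0 n
        ≤⟨ m≤m+n (r 0 n) (rangeFactor * prefixSum 0) ⟩
      r 0 n + rangeFactor * prefixSum 0
        ≤⟨ runtime-bound b z≤n (m≤m+n b 0) (λ _ _ → z≤n)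
             (λ i pi<n → p-cancel-< (<-≤-trans pi<n n≤p)) ⟩
      rangeFactor * prefixSum b
        ≤⟨ *-monoʳ-≤ rangeFactor sum≤ ⟩
      rangeFactor * ((suc c + 1) * n)
        ≡⟨ *-assoc rangeFactor (suc c + 1) n ⟨
      rangeFactor * (suc c + 1) * n ∎

-- Rational bounds for sums, products, reciprocals and logarithms of reals.

open import Data.Rational.Base
open import Data.Rational.Properties
open import Data.Rational.Solver using (module +-*-Solver)
open import Algebra.Properties.CommutativeSemiring.Exp
  (CommutativeRing.commutativeSemiring +-*-commutativeRing) using (_^_)

open +-*-Solver
open ℝ

ι-cancel-≤ : ∀ {m n} → ι m ≤ ι n → m ℕ.≤ n
ι-cancel-≤ {m} {n} m≤n = ℕₚ.≤-pred (ι-cancel-< (≤-<-trans m≤n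
  (<-by 1ℚ 0<1 (trans (+-comm (ι n) 1ℚ) (sym (ι-suc n))))))

-- Membership in the cut needs a bound strictly above `u + v`, so `u` is first moved up within its
-- open cut. The upper corner of the box is arbitrary, since addition is monotone.
L-+ᴿ : ∀ x y {u v} → L x u → L y v → L (x +ᴿ y) (u + v)
L-+ᴿ x y {u} {v} Lu Lv =
  let u′ , u<u′ , Lu′ = L-open x Lu
  in u′ + v , +-monoˡ-< v u<u′ ,
     record { Lx = Lu′ ; Ux = proj₂ (U-inhab x) ; Ly = Lv ; Uy = proj₂ (U-inhab y) } ,
     λ s t ((u′≤s , _) , (v≤t , _)) → +-mono-≤ u′≤s v≤t

U-+ᴿ : ∀ x y {u v} → U x u → U y v → U (x +ᴿ y) (u + v)
U-+ᴿ x y {u} {v} Uu Uv =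
  let u′ , u′<u , Uu′ = U-open x Uu
  in u′ + v , +-monoˡ-< v u′<u ,
     record { Lx = proj₂ (L-inhab x) ; Ux = Uu′ ; Ly = proj₂ (L-inhab y) ; Uy = Uv } ,
     λ s t ((_ , s≤u′) , (_ , t≤v)) → +-mono-≤ s≤u′ t≤v

-- The lower corner of the box provides the two summands.
L-+ᴿ⁻ : ∀ x y {w} → L (x +ᴿ y) w → ∃[ u ] ∃[ v ] L x u × L y v × w ≤ u + v
L-+ᴿ⁻ x y (q , w<q , B , lower) = x₁ , y₁ , Lx , Ly ,
  ≤-trans (<⇒≤ w<q) (lower x₁ y₁
    ((≤-refl , <⇒≤ (L<U x Lx Ux)) , (≤-refl , <⇒≤ (L<U y Ly Uy))))
  where open Box B

L-*ᴿ : ∀ x y {u v} → 0ℚ < u → L x u → 0ℚ < v → L y v → L (x *ᴿ y) (u * v)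
L-*ᴿ x y {u} {v} 0<u Lu 0<v Lv =
  let v′ , v<v′ , Lv′ = L-open y Lv
  in u * v′ , *-monoʳ-<-pos u {{positive 0<u}} v<v′ ,
     record { Lx = Lu ; Ux = proj₂ (U-inhab x) ; Ly = Lv′ ; Uy = proj₂ (U-inhab y) } ,
     λ s t ((u≤s , _) , (v′≤t , _)) →
       *-mono-0≤ (<⇒≤ 0<u) u≤s (<⇒≤ (<-trans 0<v v<v′)) v′≤t

-- The corner `y₁` may be negative, where multiplication reverses order. Evaluating at `y₁ ⊔ v₀`,
-- still below `y` but positive, lets `x₁ < b` pass to the product.
L-*ᴿ⁻ : ∀ x y {b w} → U x b → 0ℚ < b → 0ᴿ <ᴿ y → L (x *ᴿ y) w → ∃[ v ] L y v × w ≤ b * v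
L-*ᴿ⁻ x y {b} Ub 0<b (v₀ , 0<v₀ , Lv₀) (q , w<q , B , lower) =
  v , Lv , ≤-trans (<⇒≤ w<q) (≤-trans
    (lower x₁ v ((≤-refl , <⇒≤ (L<U x Lx Ux)) , (p≤p⊔q y₁ v₀ , <⇒≤ (L<U y Lv Uy))))
    (*-monoʳ-≤-nonNeg v {{nonNegative (≤-trans (<⇒≤ 0<v₀) (p≤q⊔p y₁ v₀))}}
      (<⇒≤ (L<U x Lx Ub))))
  where
  open Box B
  v = y₁ ⊔ v₀
  Lv = L-⊔ y Ly Lv₀

L-reciprocal : ∀ x (0<x : 0ᴿ <ᴿ x) {b r} → U x b → r * b < 1ℚ → 0ℚ < b → L (reciprocal x 0<x) r
L-reciprocal x 0<x {b} {r} Ub rb<1 0<b =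
  let e , 0<e , eb≡1 = inverse 0<b
  in e , *-cancelʳ-<-nonNeg b {{nonNegative (<⇒≤ 0<b)}} (subst (r * b <_) (sym eb≡1) rb<1) ,
     b , Ub , ≤-reflexive eb≡1

bernoulli-+ : ∀ {δ} n → 0ℚ ≤ δ → 1ℚ + ι n * δ ≤ (1ℚ + δ) ^ n
bernoulli-+ {δ} zero 0≤δ = ≤-reflexive (cong (1ℚ +_) (*-zeroˡ δ))
bernoulli-+ {δ} (suc n) 0≤δ = ≤-trans
  (≤-by (ι n * (δ * δ)) (0≤* (0≤ι n) (0≤* 0≤δ 0≤δ))
    (trans (cong (λ z → 1ℚ + z * δ + ι n * (δ * δ)) (ι-suc n))
      (solve 2 (λ x d → con 1ℚ :+ (con 1ℚ :+ x) :* d :+ x :* (d :* d)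
                        := (con 1ℚ :+ d) :* (con 1ℚ :+ x :* d)) refl (ι n) δ)))
  (*-monoˡ-≤-nonNeg (1ℚ + δ) {{nonNegative (0≤+ (<⇒≤ 0<1) 0≤δ)}} (bernoulli-+ n 0≤δ))

-- For a rational `1 < c < y` and `B` with `B (c - 1) > 1`, Bernoulli gives `2 ≤ c ^ B`, so `1 / B`
-- bounds `log₂ c` from below.
0<log₂ : ∀ y (0<y : 0ᴿ <ᴿ y) → 1ᴿ <ᴿ y → 0ᴿ <ᴿ log₂ y 0<y
0<log₂ y 0<y (c , 1<c , Lc) = byPower (archimedean 1ℚ (0<q-p 1<c))
  where
  byPower : ∃[ n ] 1ℚ < ι n * (c - 1ℚ) → 0ᴿ <ᴿ log₂ y 0<y
  byPower (zero , 1<0) = ⊥-elim (<-asym 0<1 (subst (1ℚ <_) (*-zeroˡ (c - 1ℚ)) 1<0))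
  byPower (suc b , 1<B[c-1]) =
    let e , 0<e , eB≡1 = inverse {ι (suc b)} (<-≤-trans 0<1 (1≤ι-suc b))
        p , 0<p , p<e = <-dense 0<e
    in p , 0<p , e , p<e , c , Lc , <-trans 0<1 1<c , 1 , 0 , b ,
       trans (+-identityʳ (e * ι (suc b))) eB≡1 ,
       ≤-trans (+-monoʳ-≤ 1ℚ (<⇒≤ 1<B[c-1]))
         (subst (1ℚ + ι (suc b) * (c - 1ℚ) ≤_)
           (trans (cong (_^ suc b) (p+[q-p]≡q 1ℚ c)) (sym (*-identityˡ (c ^ suc b))))
           (bernoulli-+ (suc b) (<⇒≤ (0<q-p 1<c))))

*<1-open : ∀ {q r} → 0ℚ < q → r * q < 1ℚ → ∃[ s ] r < s × s * q < 1ℚ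
*<1-open {q} {r} 0<q rq<1 =
  let t , _ , tq≡1 = inverse {q} 0<q
      s , r<s , s<t = <-dense {r} {t} (*-cancelʳ-<-nonNeg q {{nonNegative (<⇒≤ 0<q)}}
                                (subst (r * q <_) (sym tq≡1) rq<1))
  in s , r<s , subst (s * q <_) tq≡1 (*-monoˡ-<-pos q {{positive 0<q}} s<t)

L-down-≤ : ∀ x {u v} → u ≤ v → L x v → L x u
L-down-≤ x u≤v Lv = let w , v<w , Lw = L-open x Lv in L-down x (≤-<-trans u≤v v<w) Lw

-- The argument of the logarithm exceeds 1.

module _ (α : ℝ) (1<α : 1ᴿ <ᴿ α) where

  -- For rationals `a < α < b` with `b ≤ a + 1/4`, one has `α - 1 < b - 1/2 < a`. Hence some `s`
  -- above `1 / a` is still below `1 / (b - 1/2)`, and `a * s` separates 1 from the quotient.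
  1<α/[α-1] : 1ᴿ <ᴿ divide α (α -ᴿ 1ᴿ) (1<x⇒0<x-1 α 1<α)
  1<α/[α-1] =
    let a₀ , 1<a₀ , La₀ = 1<α
        a , b , La , Ub , a₀≤a , _ , b≤a+¼ =
          approximateWithin α La₀ (proj₂ (U-inhab α)) (0<* 0<½ 0<½)
        1<a = <-≤-trans 1<a₀ a₀≤a
        0<a = <-trans 0<1 1<a
        0<b-½ = 0<q-p {½} {b} (<-trans (<-by ½ 0<½ refl) (<-trans 1<a (L<U α La Ub)))
        b-½<a = ≤-<-trans (+-monoˡ-≤ (- ½) b≤a+¼) (<-by (½ * ½) (0<* 0<½ 0<½)
          (solve 1 (λ a → a :+ con ½ :* con ½ :+ con (- ½) :+ con ½ :* con ½ := a) refl a))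
        r , 0<r , ra≡1 = inverse 0<a
        s , r<s , s[b-½]<1 = *<1-open 0<b-½
          (subst (r * (b - ½) <_) ra≡1 (*-monoʳ-<-pos r {{positive 0<r}} b-½<a))
    in a * s ,
       subst (_< a * s) (trans (*-comm a r) ra≡1) (*-monoʳ-<-pos a {{positive 0<a}} r<s) ,
       L-*ᴿ α (reciprocal (α -ᴿ 1ᴿ) (1<x⇒0<x-1 α 1<α)) 0<a La (<-trans 0<r r<s)
         (L-reciprocal (α -ᴿ 1ᴿ) (1<x⇒0<x-1 α 1<α)
           (U-+ᴿ α (-ᴿ 1ᴿ) {b} { - ½} Ub (<-by ½ 0<½ refl)) s[b-½]<1 0<b-½)

  -- Estimates for powers and power sums, from rationals `1 < a < α < b`.

  private
    a = proj₁ 1<α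
    1<a = proj₁ (proj₂ 1<α)
    La = proj₂ (proj₂ 1<α)
    0<a = <-trans 0<1 1<a
    b = proj₁ (U-inhab α)
    Ub = proj₂ (U-inhab α)
    0<b = <-trans 0<a (L<U α La Ub)

    r = proj₁ (inverse 0<a)
    0<r = proj₁ (proj₂ (inverse 0<a))
    ar≡1 : a * r ≡ 1ℚ
    ar≡1 = trans (*-comm a r) (proj₂ (proj₂ (inverse 0<a)))
    r<1 : r < 1ℚ
    r<1 = subst₂ _<_ (*-identityˡ r) ar≡1 (*-monoˡ-<-pos r {{positive 0<r}} 1<a)

  mutual
    -- The open lower cut of `α ^ᴿ 0` omits 1, so the induction carries `r = 1 / a` instead; one
    -- more factor `a` lifts it to 1.
    1<^ᴿ-suc : ∀ k → L (α ^ᴿ suc k) 1ℚ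
    1<^ᴿ-suc k = subst (L (α ^ᴿ suc k)) ar≡1 (L-*ᴿ α (α ^ᴿ k) 0<a La 0<r (L-^ᴿ k))

    L-^ᴿ : ∀ k → L (α ^ᴿ k) r
    L-^ᴿ zero = r<1
    L-^ᴿ (suc k) = L-down (α ^ᴿ suc k) r<1 (1<^ᴿ-suc k)

  -- The product rule wants positive factors while `u` may be negative, hence the detour through
  -- `u ⊔ r`.
  L-^ᴿ-suc : ∀ k {u} → L (α ^ᴿ k) u → L (α ^ᴿ suc k) (a * u)
  L-^ᴿ-suc k {u} Lu =
    L-down-≤ (α ^ᴿ suc k) (*-monoˡ-≤-nonNeg a {{nonNegative (<⇒≤ 0<a)}} (p≤p⊔q u r))
      (L-*ᴿ α (α ^ᴿ k) 0<a La (<-≤-trans 0<r (p≤q⊔p u r)) (L-⊔ (α ^ᴿ k) Lu (L-^ᴿ k)))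

  -- One half of `S (i + 1) = 1 + α S i` for the geometric sums `S`, with `t` and `a` approximating
  -- 1 and `α` from below. The sums grow at the top power, so the induction splits `u` into a
  -- shorter sum and that power.
  powerSum-lower : ∀ i {t u} → t < 1ℚ → L (powerSum α i) u → L (powerSum α (suc i)) (t + a * u)
  powerSum-lower zero t<1 Lu = L-+ᴿ 1ᴿ (α ^ᴿ 1) t<1 (L-^ᴿ-suc 0 Lu)
  powerSum-lower (suc i) {t} {u} t<1 Lu =
    let v , w , Lv , Lw , u≤v+w = L-+ᴿ⁻ (powerSum α i) (α ^ᴿ suc i) Lu
    in L-down-≤ (powerSum α (suc (suc i)))
         (≤-trans (+-monoʳ-≤ t (*-monoˡ-≤-nonNeg a {{nonNegative (<⇒≤ 0<a)}} u≤v+w))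
           (≤-reflexive (solve 4 (λ t a v w → t :+ a :* (v :+ w) := t :+ a :* v :+ a :* w)
             refl t a v w)))
         (L-+ᴿ (powerSum α (suc i)) (α ^ᴿ suc (suc i))
           (powerSum-lower i t<1 Lv) (L-^ᴿ-suc (suc i) Lw))

  -- The other half of the same identity, with `b` above `α`.
  powerSum-upper : ∀ i {v} → L (powerSum α (suc i)) v →
    ∃[ u ] L (powerSum α i) u × v ≤ 1ℚ + b * u
  powerSum-upper zero Lv =
    let w , z , w<1 , Lz , v≤w+z = L-+ᴿ⁻ 1ᴿ (α ^ᴿ 1) Lv
        u , Lu , z≤bu = L-*ᴿ⁻ α (α ^ᴿ 0) Ub 0<b (r , 0<r , L-^ᴿ 0) Lz
    in u , Lu , ≤-trans v≤w+z (+-mono-≤ (<⇒≤ w<1) z≤bu)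
  powerSum-upper (suc i) Lv =
    let w , z , Lw , Lz , v≤w+z = L-+ᴿ⁻ (powerSum α (suc i)) (α ^ᴿ suc (suc i)) Lv
        u , Lu , w≤1+bu = powerSum-upper i Lw
        u′ , Lu′ , z≤bu′ = L-*ᴿ⁻ α (α ^ᴿ suc i) Ub 0<b (r , 0<r , L-^ᴿ (suc i)) Lz
    in u + u′ , L-+ᴿ (powerSum α i) (α ^ᴿ suc i) Lu Lu′ ,
       ≤-trans v≤w+z (≤-trans (+-mono-≤ w≤1+bu z≤bu′) (≤-reflexive
         (solve 3 (λ b u v → con 1ℚ :+ b :* u :+ b :* v := con 1ℚ :+ b :* (u :+ v))
           refl b u u′)))

  -- Growth of the pivots despite rounding.

  module _ (p : ℕ → ℕ) (pivots : IsPivots α p) where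

    <pivot : ∀ i {u} → L (powerSum α i) u → u < ι (p i)
    <pivot i = proj₁ (pivots i) _

    -- A rational between `p i` and `powerSum α i + 1` splits into two shares; the share of 1 stays
    -- below 1.
    pivot-1< : ∀ i → ∃[ u ] L (powerSum α i) u × ι (p i) - 1ℚ < u
    pivot-1< i =
      let q , p<q , Lq = proj₂ (pivots i)
          u , v , Lu , v<1 , q≤u+v = L-+ᴿ⁻ (powerSum α i) 1ᴿ Lq
      in u , Lu , subst (ι (p i) - 1ℚ <_)
           (solve 1 (λ u → u :+ con 1ℚ :- con 1ℚ := u) refl u)
           (+-monoˡ-< (- 1ℚ) (<-trans p<q (≤-<-trans q≤u+v (+-monoʳ-< u v<1))))

    pivot-zero : 0 ℕ.< p 0
    pivot-zero = ι-cancel-< {0} {p 0} (<pivot 0 0<1)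

    -- The next power of `α` exceeds 1, which outweighs the rounding error of the ceiling.
    pivot-increasing : ∀ i → p i ℕ.< p (suc i)
    pivot-increasing i =
      let u , Lu , p-1<u = pivot-1< i
      in ι-cancel-< (<-trans
        (subst (_< u + 1ℚ) (solve 1 (λ x → x :- con 1ℚ :+ con 1ℚ := x) refl (ι (p i)))
          (+-monoˡ-< 1ℚ p-1<u))
        (<pivot (suc i) (L-+ᴿ (powerSum α i) (α ^ᴿ suc i) Lu (1<^ᴿ-suc i))))

    1≤pivot : ∀ i → 1ℚ ≤ ι (p i)
    1≤pivot zero = ι-mono-≤ pivot-zero
    1≤pivot (suc i) = ι-mono-≤ (ℕₚ.≤-<-trans ℕ.z≤n (pivot-increasing i))

    -- The upper estimate gives `p (suc i) ≤ 2 + b * p i`, and `1 ≤ p i` turns the constant into a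
    -- factor.
    pivot-ratio-≤ : ∃[ M ] (∀ i → p (suc i) ℕ.≤ M ℕ.* p i)
    pivot-ratio-≤ =
      let M , 2+b<M = ι-bound (2ℚ + b)
      in M , λ i →
        let v , Lv , p′-1<v = pivot-1< (suc i)
            u , Lu , v≤1+bu = powerSum-upper i Lv
            P = ι (p i)
        in ι-cancel-≤ (≤-trans
          (subst₂ _≤_ (solve 1 (λ x → x :- con 1ℚ :+ con 1ℚ := x) refl (ι (p (suc i))))
            (solve 1 (λ x → con 1ℚ :+ x :+ con 1ℚ := con 2ℚ :* con 1ℚ :+ x) refl (b * P))
            (+-monoˡ-≤ 1ℚ (≤-trans (<⇒≤ p′-1<v) (≤-trans v≤1+bu
              (+-monoʳ-≤ 1ℚ (*-monoˡ-≤-nonNeg b {{nonNegative (<⇒≤ 0<b)}}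
                (<⇒≤ (<pivot i Lu))))))))
          (≤-trans (+-monoˡ-≤ (b * P) (*-monoˡ-≤-nonNeg 2ℚ (1≤pivot i)))
            (subst₂ _≤_ (*-distribʳ-+ P 2ℚ b) (sym (ι-* M (p i)))
              (*-monoʳ-≤-nonNeg P {{nonNegative (0≤ι (p i))}} (<⇒≤ 2+b<M)))))

    1+a[pivot-1]≤ : ∀ i → 1ℚ + a * (ι (p i) - 1ℚ) ≤ ι (p (suc i))
    1+a[pivot-1]≤ i =
      let u , Lu , p-1<u = pivot-1< i
          q = ι (p i) - 1ℚ
          0<a[u-q] = 0<* 0<a (0<q-p p-1<u)
          -- The excess of `u` over `q` pays for `t` falling short of 1: `t + a * u` is exactly
          -- `1 + a * q`.
          t<1 = <-by {1ℚ - a * (u - q)} {1ℚ} (a * (u - q)) 0<a[u-q]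
                  (solve 1 (λ x → con 1ℚ :- x :+ x := con 1ℚ) refl (a * (u - q)))
      in subst (_≤ ι (p (suc i)))
           (solve 3 (λ a u q → con 1ℚ :- a :* (u :- q) :+ a :* u := con 1ℚ :+ a :* q) refl a u q)
           (<⇒≤ (<pivot (suc i) (powerSum-lower i t<1 Lu)))

    -- With `c (a - 1) > 1`, the product of the nonnegative `c (a - 1) - 1` and `p i - 1` is the
    -- slack between `suc c * p i` and `c * (1 + a * (p i - 1)) + 1`.
    pivot-ratio-≥ : ∃[ c ] (∀ i → suc c ℕ.* p i ℕ.≤ c ℕ.* p (suc i) ℕ.+ 1)
    pivot-ratio-≥ =
      let c , 1<c[a-1] = archimedean 1ℚ (0<q-p 1<a)
      in c , λ i →
        let P = ι (p i)
            C = ι c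
        in ι-cancel-≤ (subst₂ _≤_
          (sym (trans (ι-* (suc c) (p i)) (cong (_* P) (ι-suc c))))
          (sym (trans (ι-+ (c ℕ.* p (suc i)) 1) (cong (_+ 1ℚ) (ι-* c (p (suc i))))))
          (≤-trans
            (≤-by ((C * (a - 1ℚ) - 1ℚ) * (P - 1ℚ))
              (0≤* (0≤q-p (<⇒≤ 1<c[a-1])) (0≤q-p (1≤pivot i)))
              (solve 3 (λ c a x → (con 1ℚ :+ c) :* x :+ (c :* (a :- con 1ℚ) :- con 1ℚ) :* (x :- con 1ℚ)
                         := c :* (con 1ℚ :+ a :* (x :- con 1ℚ)) :+ con 1ℚ) refl C a P))
            (+-monoˡ-≤ 1ℚ (*-monoˡ-≤-nonNeg C {{nonNegative (0≤ι c)}} (1+a[pivot-1]≤ i)))))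

-- From a linear bound to the big O statement.

linear-∈O : ∀ (f : ℕ → ℕ) y → 0ᴿ <ᴿ y → (∃[ K ] (∀ n → f n ℕ.≤ K ℕ.* n)) →
  (λ n → fromℕ (f n)) ∈O (λ n → fromℕ n *ᴿ y)
linear-∈O f y (l , 0<l , Ll) (K , f≤Kn) =
  let m , 0<m , ml≡1 = inverse 0<l
      -- The factor 2 makes up for replacing `n` by `n / 2`, which lies in the open lower cut of
      -- `n`; `suc K` keeps `C` positive when `K` is 0.
      C = 2ℚ * ι (suc K) * m
      0<C = 0<* (0<* 0<2 (<-≤-trans 0<1 (1≤ι-suc K))) 0<m
      C<C+1 = <-by 1ℚ 0<1 refl
  -- The constant `C + 1` has `C` strictly below it, and the threshold 1 makes `n` positive.
  in fromℚ (C + 1ℚ) , (C , 0<C , C<C+1) , 1 , λ n 1≤n q q<fn →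
    let 0<n = <-≤-trans 0<1 (ι-mono-≤ {1} {n} 1≤n)
        0<n½ = 0<* 0<n 0<½
        n½<n = <-by (ι n * ½) 0<n½ (solve 1 (λ n → n :* con ½ :+ n :* con ½ := n) refl (ι n))
    in L-down-≤ (fromℚ (C + 1ℚ) *ᴿ (fromℕ n *ᴿ y))
         (≤-trans (<⇒≤ q<fn) (≤-trans
           (ι-mono-≤ (ℕₚ.≤-trans (f≤Kn n) (ℕₚ.*-monoˡ-≤ n (ℕₚ.n≤1+n K))))
           (≤-reflexive (trans (ι-* (suc K) n) (trans (sym (*-identityʳ (ι (suc K) * ι n)))
             (trans (cong (ι (suc K) * ι n *_) (sym ml≡1))
             (solve 4 (λ k n m l → k :* n :* (m :* l) := con 2ℚ :* k :* m :* (n :* con ½ :* l))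
               refl (ι (suc K)) (ι n) m l)))))))
         (L-*ᴿ (fromℚ (C + 1ℚ)) (fromℕ n *ᴿ y) 0<C C<C+1 (0<* 0<n½ 0<l)
           (L-*ᴿ (fromℕ n) y 0<n½ n½<n 0<l Ll))

linear-∈O-log₂ : ∀ (f : ℕ → ℕ) y (0<y : 0ᴿ <ᴿ y) → 1ᴿ <ᴿ y →
  (∃[ K ] (∀ n → f n ℕ.≤ K ℕ.* n)) →
  (λ n → fromℕ (f n)) ∈O (λ n → fromℕ n *ᴿ log₂ y 0<y)
linear-∈O-log₂ f y 0<y 1<y = linear-∈O f (log₂ y 0<y) (0<log₂ y 0<y 1<y)

lohRuntime-linear : ∀ (α : ℝ) (1<α : 1ᴿ <ᴿ α) (p : ℕ → ℕ) → IsPivots α p →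
  (x r : ℕ → ℕ → ℕ) → IsClosestPivot p x → IsRuntime p x r →
  ∃[ K ] (∀ n → r 0 n ℕ.≤ K ℕ.* n)
lohRuntime-linear α 1<α p pivots x r closest runtime =
  let c , ratio≥ = pivot-ratio-≥ α 1<α p pivots
      M , ratio≤ = pivot-ratio-≤ α 1<α p pivots
      open GeometricPivots p c M (pivot-zero α 1<α p pivots) (pivot-increasing α 1<α p pivots)
        ratio≤ ratio≥
  in rangeFactor x r closest runtime ℕ.* (suc c ℕ.+ 1) , runtime-linear x r closest runtime

theorem2p8 : ∀ (α : ℝ) (1<α : 1ᴿ <ᴿ α) (p : ℕ → ℕ) → IsPivots α p →
    (x r : ℕ → ℕ → ℕ) → IsClosestPivot p x → IsRuntime p x r →
    (λ n → fromℕ (r 0 n)) ∈O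
    (λ n → fromℕ n *ᴿ log₂ (divide α (α -ᴿ 1ᴿ) (1<x⇒0<x-1 α 1<α)) (0<x/[x-1] α 1<α))
theorem2p8 α 1<α p pivots x r closest runtime =
  linear-∈O-log₂ (r 0) (divide α (α -ᴿ 1ᴿ) (1<x⇒0<x-1 α 1<α)) (0<x/[x-1] α 1<α)
    (1<α/[α-1] α 1<α) (lohRuntime-linear α 1<α p pivots x r closest runtime)
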